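{- Let $n\ge1$, let $\lambda$ be an admitted vector of type $A_n$, let $1\le i<j\le n+1$, $\alpha:=e_i-e_j$, let $t:=s_{k,\ell}\in W(A_n)=S_{n+1}$ be the transposition exchanging $k$ and $\ell$, where $1\le k<\ell\le n+1$, and let $B_{i,j}:=B_{i,j}(k,\ell)$. Then $$(t\diamond\lambda)_{i,j}=\begin{cases}\lambda_{t(i),t(j)}-\displaystyle\int_i^j\gamma_t(\lambda,v)\,dv+|B_{i,j}| & \text{if }\alpha\notin N(t),\\[2mm] \lambda_{t(i),t(j)}-\displaystyle\int_i^j\gamma_t(\lambda,v)\,dv+|B_{i,j}|-1 & \text{if }\alpha\in N(t).\end{cases}$$
   Context: Let $W(A_n)=S_{n+1}$ act on $\mathbb{R}^{n+1}$ with canonical basis $e_1,\dots,e_{n+1}$ by $\sigma(e_i)=e_{\sigma(i)}$, and let $\Phi^+=\{e_i-e_j : 1\le i<j\le n+1\}$, $\Phi^-=-\Phi^+$. For $w\in W(A_n)$, the inversion set is $N(w)=\{\xi\in\Phi^+ : w^{ -1}(\xi)\in\Phi^-\}$. Let $m=n(n+1)/2$ and index coordinates of $\mathbb{R}^m$ by pairs $(i,j)$, $1\le i<j\le n+1$. An admitted vector is a vector of integers $\lambda=(\lambda_{i,j})_{1\le i<j\le n+1}$ such that $\lambda_{i,i+1}=0$ for all $1\le i\le n$ and $\lambda_{i,j}+\lambda_{j,k}\le\lambda_{i,k}\le\lambda_{i,j}+\lambda_{j,k}+1$ for all $i<j<k$. Convention: for any vector $x\in\mathbb{R}^m$ (in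 particular for $\lambda$), $x_{b,a}:=-x_{a,b}$ for $a<b$. For an admitted vector $\lambda$, let $X_{W(\widetilde{A}_n)}[\lambda]=\{x\in\mathbb{R}^m : x_{i,j}=\sum_{r=i}^{j-1}x_{r,r+1}+\lambda_{i,j}\text{ for all }1\le i<j\le n+1\}$, and let $\widehat{X}_{W(\widetilde{A}_n)}=\bigsqcup_{\lambda\text{ admitted}}X_{W(\widetilde{A}_n)}[\lambda]$. The $\Phi^+$-representation (restricted to $W(A_n)$) is the homomorphism $F:W(A_n)\to\mathrm{Isom}(\mathbb{R}^m)$ given, for $i<j$, by $F(w)(x)_{i,j}=x_{w^{ -1}(i),w^{ -1}(j)}$ if $w^{ -1}(i)<w^{ -1}(j)$, and $F(w)(x)_{i,j}=-x_{w^{ -1}(j),w^{ -1}(i)}-1$ if $w^{ -1}(i)>w^{ -1}(j)$. It is known that each $F(w)$ permutes the sets $X_{W(\widetilde{A}_n)}[\lambda]$, $\lambda$ admitted. The action $\diamond$ of $W(A_n)$ on admitted vectors is defined by: $w\diamond\lambda$ is the admitted vector with $F(w)(X_{W(\widetilde{A}_n)}[\lambda])=X_{W(\widetilde{A}_n)}[w\diamond\lambda]$. For $i<j$: $B_{i,j}(k,\ell)=\{p\in\{i,\dots,j-1\} : e_p-e_{p+1}\in N(s_{k,\ell})\}$. For $w\in W(A_n)$, $x\in\widehat{X}_{W(\widetilde{A}_n)}$ and real $v\in[1,n+1)$, put $\gamma_w(x,v):=x_{w(\lfloor v\rfloor),w(\lfloor v+1\rfloor)}$, a step function of $v$ (the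 value at $v=n+1$ is irrelevant for integrals). Note that every admitted vector $\lambda$ is itself a point of $\widehat{X}_{W(\widetilde{A}_n)}$, so $\gamma_t(\lambda,v)$ makes sense. -}

module Defs where

open import Algebra.Bundles using (CommutativeRing)
open import Data.Bool.Base using (if_then_else_)
open import Data.Empty using (⊥-elim-irr; ⊥-elim)
open import Data.Fin.Base as Fin using (Fin; zero; suc; toℕ; inject₁; fromℕ<)
open import Data.Fin.Permutation using (Permutation′; _⟨$⟩ʳ_; _⟨$⟩ˡ_; flip; inverseʳ; transpose)
import Data.Fin.Properties as Fin
open import Data.Integer.Base as ℤ using (ℤ; +_; -[1+_])
import Data.Integer.Properties as ℤ
open import Data.Integer.Tactic.RingSolver using (solve-∀)
open import Data.List.Base using (List; []; _∷_; foldr; map; filter; allFin; tabulate)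
open import Data.List.Properties using (map-tabulate; filter-none)
open import Data.List.Relation.Unary.All using (universal)
open import Data.Maybe.Base using (Maybe; just; nothing)
open import Data.Nat.Base as ℕ using (ℕ; zero; suc; z≤n; s≤s)
import Data.Nat.Properties as ℕ
open import Data.Product.Base using (∃; ∃₂; _×_; _,_; proj₁; proj₂)
open import Data.Sum.Base using (_⊎_; inj₁; inj₂)
open import Data.Vec.Functional using (Vector)
open import Function.Base using (_∘_)
open import Level using (0ℓ)
open import Relation.Binary.Core using (Rel)
open import Relation.Binary.Definitions using (tri<; tri≈; tri>)
open import Relation.Binary.Structures using (IsStrictTotalOrder)
open import Relation.Binary.PropositionalEquality.Core as ≡ using (_≡_)
open import Relation.Nullary using (¬_; yes; no; does)
open import Relation.Nullary.Decidable using (_×-dec_)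
open import Relation.Unary using (Pred; Decidable; _≐_)

-- Fields are discrete: the order is decidably total, so equality is decidable.
record OrderedField : Set₁ where
  field
    commutativeRing : CommutativeRing 0ℓ 0ℓ

  open CommutativeRing commutativeRing public hiding (zero)

  infix 4 _<_ _≤_

  field
    _<_                : Rel Carrier 0ℓ
    isStrictTotalOrder : IsStrictTotalOrder _≈_ _<_
    0<1                : 0# < 1#
    +-monoˡ-<          : ∀ z {x y} → x < y → x + z < y + z
    *-pos              : ∀ {x y} → 0# < x → 0# < y → 0# < x * y
    inverse            : ∀ x → ¬ x ≈ 0# → ∃ λ y → x * y ≈ 1#

  _≤_ : Rel Carrier 0ℓ
  x ≤ y = x < y ⊎ x ≈ y

  open import Algebra.Properties.Monoid.Mult +-monoid public
    using () renaming (_×_ to _×ℕ_)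

  ι : ℤ → Carrier
  ι (+ n)    = n ×ℕ 1#
  ι -[1+ n ] = - (suc n ×ℕ 1#)

  UpperBound : Pred Carrier 0ℓ → Pred Carrier 0ℓ
  UpperBound S u = ∀ x → S x → x ≤ u

-- The real numbers, axiomatised (classically) as a Dedekind-complete
-- ordered field.  The Archimedean property takes the form of a floor function.
record Reals : Set₁ where
  field
    orderedField : OrderedField

  open OrderedField orderedField public

  field
    ⌊_⌋     : Carrier → ℤ
    floor-≤ : ∀ x → ι ⌊ x ⌋ ≤ x
    <-floor : ∀ x → x < ι (⌊ x ⌋ ℤ.+ + 1)

    supremum : ∀ (S : Pred Carrier 0ℓ) → ∃ S → ∃ (UpperBound S) →
               ∃ λ s → UpperBound S s × (∀ u → UpperBound S u → s ≤ u)

-- The index a ∈ {1,…,n+1} is the element of Fin (suc n) with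
-- toℕ equal to a - 1; p : Fin n stands for the consecutive pair (p , p+1),
-- that is (inject₁ p , suc p).

Coords : Set → ℕ → Set
Coords A n = (i j : Fin (suc n)) → .(i Fin.< j) → A

p<p+1 : ∀ {n} (p : Fin n) → inject₁ p Fin.< suc p
p<p+1 p = s≤s (ℕ.≤-reflexive (Fin.toℕ-inject₁ p))

record Admitted (n : ℕ) : Set where
  field
    entry  : Coords ℤ n
    simple : ∀ p → entry (inject₁ p) (suc p) (p<p+1 p) ≡ + 0
    lower  : ∀ {i j k} (i<j : i Fin.< j) (j<k : j Fin.< k) →
             entry i j i<j ℤ.+ entry j k j<k ℤ.≤ entry i k (Fin.<-trans i<j j<k)
    upper  : ∀ {i j k} (i<j : i Fin.< j) (j<k : j Fin.< k) →
             entry i k (Fin.<-trans i<j j<k) ℤ.≤ entry i j i<j ℤ.+ entry j k j<k ℤ.+ + 1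

open Admitted public

Between : ∀ {n} (i j : Fin (suc n)) → Pred (Fin n) 0ℓ
Between i j p = i Fin.≤ inject₁ p × suc p Fin.≤ j

between? : ∀ {n} (i j : Fin (suc n)) → Decidable (Between i j)
between? i j p = (i Fin.≤? inject₁ p) ×-dec (suc p Fin.≤? j)

-- {i,…,j-1}, as a set of consecutive pairs.
interval : ∀ {n} (i j : Fin (suc n)) → List (Fin n)
interval {n} i j = filter (between? i j) (allFin n)

-- Converts a 1-based index.
index : ∀ n → ℤ → Maybe (Fin (suc n))
index n (+ suc m) with m ℕ.<? suc n
... | yes m<1+n = just (fromℕ< m<1+n)
... | no  _     = nothing
index n _ = nothing

module OverReals ⦃ ℝ : Reals ⦄ where
  open Reals ℝ

  -- σ (e_i) = e_{σ(i)}, extended linearly.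
  infixr 7 _·_
  _·_ : ∀ {n} → Permutation′ (suc n) → Vector Carrier (suc n) → Vector Carrier (suc n)
  (w · ξ) p = ξ (w ⟨$⟩ˡ p)

  e : ∀ {n} → Fin (suc n) → Vector Carrier (suc n)
  e i p = if does (i Fin.≟ p) then 1# else 0#

  root : ∀ {n} → Fin (suc n) → Fin (suc n) → Vector Carrier (suc n)
  root i j p = e i p - e j p

  Φ⁺ Φ⁻ : ∀ {n} → Pred (Vector Carrier (suc n)) 0ℓ
  Φ⁺ ξ = ∃₂ λ i j → i Fin.< j × (∀ p → ξ p ≈ root i j p)
  Φ⁻ ξ = Φ⁺ λ p → - ξ p

  -- The permutation flip w is w⁻¹.
  N : ∀ {n} → Permutation′ (suc n) → Pred (Vector Carrier (suc n)) 0ℓ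
  N w ξ = Φ⁺ ξ × Φ⁻ (flip w · ξ)

  Φ⁺? : ∀ {n} → Decidable (Φ⁺ {n})
  Φ⁺? ξ = Fin.any? λ i → Fin.any? λ j →
    (i Fin.<? j) ×-dec Fin.all? λ p → IsStrictTotalOrder._≟_ isStrictTotalOrder (ξ p) (root i j p)

  N? : ∀ {n} (w : Permutation′ (suc n)) → Decidable (N w)
  N? w ξ = Φ⁺? ξ ×-dec Φ⁺? (λ p → - (flip w · ξ) p)

  B : ∀ {n} (i j k l : Fin (suc n)) → List (Fin n)
  B i j k l = filter (λ p → N? (transpose k l) (root (inject₁ p) (suc p))) (interval i j)

  real : ∀ {n} → Coords ℤ n → Coords Carrier n
  real x i j i<j = ι (x i j i<j)

  -- x_{a,b} for arbitrary a ≠ b; the value at a = b is junk.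
  signed : ∀ {n} → Coords Carrier n → Fin (suc n) → Fin (suc n) → Carrier
  signed x a b with Fin.<-cmp a b
  ... | tri< a<b _ _ = x a b a<b
  ... | tri≈ _ _ _   = 0#
  ... | tri> _ _ b<a = - x b a b<a

  injective : ∀ {n} (w : Permutation′ n) {i j} → w ⟨$⟩ˡ i ≡ w ⟨$⟩ˡ j → i ≡ j
  injective w eq = ≡.trans (≡.sym (inverseʳ w)) (≡.trans (≡.cong (w ⟨$⟩ʳ_) eq) (inverseʳ w))

  -- The Φ⁺-representation restricted to the finite group.
  F : ∀ {n} → Permutation′ (suc n) → Coords Carrier n → Coords Carrier n
  F w x i j i<j with Fin.<-cmp (w ⟨$⟩ˡ i) (w ⟨$⟩ˡ j)
  ... | tri< a<b _ _ = x (w ⟨$⟩ˡ i) (w ⟨$⟩ˡ j) a<b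
  ... | tri≈ _ a≡b _ = ⊥-elim-irr (Fin.<⇒≢ i<j (injective w a≡b))
  ... | tri> _ _ b<a = - x (w ⟨$⟩ˡ j) (w ⟨$⟩ˡ i) b<a - 1#

  ∑ : ∀ {A : Set} → List A → (A → Carrier) → Carrier
  ∑ ps f = foldr (λ p s → f p + s) 0# ps

  X[_] : ∀ {n} → Admitted n → Pred (Coords Carrier n) 0ℓ
  X[ lam ] x = ∀ i j (i<j : i Fin.< j) →
    x i j i<j ≈ ∑ (interval i j) (λ p → x (inject₁ p) (suc p) (p<p+1 p)) + ι (entry lam i j i<j)

  Image : ∀ {n} → (Coords Carrier n → Coords Carrier n) →
          Pred (Coords Carrier n) 0ℓ → Pred (Coords Carrier n) 0ℓ
  Image G P y = ∃ λ x → P x × (∀ i j (i<j : i Fin.< j) → y i j i<j ≈ G x i j i<j)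

  -- The Riemann integral, in Darboux form.
  -- Bracket f b a L U: a subdivision of [a,b], with bounds l ≤ f ≤ u on each
  -- of its open pieces, whose lower sum is L and upper sum is U.
  -- Values of f at the finitely many subdivision points play no role.
  data Bracket (f : Carrier → Carrier) (b : Carrier) : (a L U : Carrier) → Set where
    end  : Bracket f b b 0# 0#
    step : ∀ {a c l u L U} → a < c →
           (∀ v → a < v → v < c → l ≤ f v × f v ≤ u) →
           Bracket f b c L U →
           Bracket f b a (l * (c - a) + L) (u * (c - a) + U)

  IsIntegral : (Carrier → Carrier) → (a b I : Carrier) → Set
  IsIntegral f a b I = ∀ ε → 0# < ε →
    ∃₂ λ L U → Bracket f b a L U × I - ε < L × U < I + ε

  Integrable : (Carrier → Carrier) → (a b : Carrier) → Set
  Integrable f a b = ∃ (IsIntegral f a b)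

  ∫ : ∀ a b (f : Carrier → Carrier) → Integrable f a b → Carrier
  ∫ a b f = proj₁

  -- The 1-based value of an index.
  pos : ∀ {n} → Fin n → Carrier
  pos i = ι (+ suc (toℕ i))

  valueAt : ∀ {n} → Permutation′ (suc n) → Coords Carrier n →
            Maybe (Fin (suc n)) → Maybe (Fin (suc n)) → Carrier
  valueAt w x (just a) (just b) = signed x (w ⟨$⟩ʳ a) (w ⟨$⟩ʳ b)
  valueAt w x _        _        = 0#

  -- Extended by 0 outside [1,n+1).
  γ : ∀ {n} → Permutation′ (suc n) → Coords Carrier n → Carrier → Carrier
  γ {n} w x v = valueAt w x (index n ⌊ v ⌋) (index n ⌊ v + 1# ⌋)

  open IsStrictTotalOrder isStrictTotalOrder
    using (compare; irrefl; asym; <-respˡ-≈; <-respʳ-≈) renaming (trans to <-trans)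
  open import Algebra.Properties.Monoid.Mult +-monoid using (×-homo-+)
  open import Algebra.Properties.AbelianGroup +-abelianGroup
    using () renaming (ε⁻¹≈ε to -0≈0; ⁻¹-involutive to -‿involutive; ⁻¹-∙-comm to -‿+-comm)
  import Algebra.Solver.CommutativeMonoid +-commutativeMonoid as CM
  open import Relation.Binary.Reasoning.Setoid setoid

  ι-⊖ : ∀ m n → ι (m ℤ.⊖ n) ≈ ι (+ m) - ι (+ n)
  ι-⊖ m zero = begin
    ι (+ m)      ≈⟨ +-identityʳ _ ⟨
    ι (+ m) + 0# ≈⟨ +-congˡ -0≈0 ⟨
    ι (+ m) - 0# ∎
  ι-⊖ zero (suc n) = sym (+-identityˡ _)
  ι-⊖ (suc m) (suc n) = begin
    ι (suc m ℤ.⊖ suc n)                ≡⟨ ≡.cong ι (ℤ.[1+m]⊖[1+n]≡m⊖n m n) ⟩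
    ι (m ℤ.⊖ n)                        ≈⟨ ι-⊖ m n ⟩
    ι (+ m) - ι (+ n)                  ≈⟨ +-identityʳ _ ⟨
    ι (+ m) - ι (+ n) + 0#             ≈⟨ +-congˡ (-‿inverseʳ 1#) ⟨
    ι (+ m) - ι (+ n) + (1# - 1#)      ≈⟨ CM.solve 4 (λ a b c d → ((a CM.⊕ b) CM.⊕ (c CM.⊕ d)) CM.⊜ ((c CM.⊕ a) CM.⊕ (d CM.⊕ b))) refl (ι (+ m)) (- ι (+ n)) 1# (- 1#) ⟩
    ι (+ suc m) + (- 1# - ι (+ n))     ≈⟨ +-congˡ (-‿+-comm 1# (ι (+ n))) ⟩
    ι (+ suc m) - ι (+ suc n)          ∎

  ι-+ : ∀ x y → ι (x ℤ.+ y) ≈ ι x + ι y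
  ι-+ (+ m)    (+ n)    = ×-homo-+ 1# m n
  ι-+ (+ m)    -[1+ n ] = ι-⊖ m (suc n)
  ι-+ -[1+ m ] (+ n)    = trans (ι-⊖ n (suc m)) (+-comm _ _)
  ι-+ -[1+ m ] -[1+ n ] = begin
    - ι (+ suc (suc (m ℕ.+ n)))       ≡⟨ ≡.cong (λ k → - ι (+ suc k)) (≡.sym (ℕ.+-suc m n)) ⟩
    - ι (+ (suc m ℕ.+ suc n))         ≈⟨ -‿cong (×-homo-+ 1# (suc m) (suc n)) ⟩
    - (ι (+ suc m) + ι (+ suc n))     ≈⟨ -‿+-comm _ _ ⟨
    - ι (+ suc m) - ι (+ suc n)       ∎

  ι-neg : ∀ x → ι (ℤ.- x) ≈ - ι x
  ι-neg (+ zero)  = sym -0≈0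
  ι-neg (+ suc n) = refl
  ι-neg -[1+ n ]  = sym (-‿involutive _)

  ι-minus : ∀ x y → ι (x ℤ.- y) ≈ ι x - ι y
  ι-minus x y = trans (ι-+ x (ℤ.- y)) (+-congˡ (ι-neg y))

  ≤-trans : ∀ {x y z} → x ≤ y → y ≤ z → x ≤ z
  ≤-trans (inj₁ p) (inj₁ q) = inj₁ (<-trans p q)
  ≤-trans (inj₁ p) (inj₂ q) = inj₁ (<-respʳ-≈ q p)
  ≤-trans (inj₂ p) (inj₁ q) = inj₁ (<-respˡ-≈ (sym p) q)
  ≤-trans (inj₂ p) (inj₂ q) = inj₂ (trans p q)

  ≤-<-trans : ∀ {x y z} → x ≤ y → y < z → x < z
  ≤-<-trans (inj₁ p) q = <-trans p q
  ≤-<-trans (inj₂ p) q = <-respˡ-≈ (sym p) q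

  x<x+1 : ∀ x → x < x + 1#
  x<x+1 x = <-respˡ-≈ (+-identityˡ x) (<-respʳ-≈ (+-comm 1# x) (+-monoˡ-< x 0<1))

  ι-1+ : ∀ x → ι (x ℤ.+ + 1) ≈ ι x + 1#
  ι-1+ x = trans (ι-+ x (+ 1)) (+-congˡ (+-identityʳ 1#))

  ι-≤-+ : ∀ x n → ι x ≤ ι (x ℤ.+ + n)
  ι-≤-+ x zero = inj₂ (reflexive (≡.cong ι (≡.sym (ℤ.+-identityʳ x))))
  ι-≤-+ x (suc n) = ≤-trans (ι-≤-+ x n) (inj₁ (<-respʳ-≈ (sym eq) (x<x+1 _)))
    where
    eq : ι (x ℤ.+ + suc n) ≈ ι (x ℤ.+ + n) + 1#
    eq = trans (reflexive (≡.cong ι (≡.trans (≡.cong (λ k → x ℤ.+ + k) (ℕ.+-comm 1 n))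
           (≡.sym (ℤ.+-assoc x (+ n) (+ 1)))))) (ι-1+ (x ℤ.+ + n))

  ι-mono : ∀ {x y} → x ℤ.≤ y → ι x ≤ ι y
  ι-mono {x} {y} x≤y with y ℤ.- x in eq | ℤ.i≤j⇒0≤j-i x≤y
  ... | + n | _ = ≡.subst (λ z → ι x ≤ ι z) (≡.trans (≡.cong (λ z → x ℤ.+ z) (≡.sym eq)) (lemma x y)) (ι-≤-+ x n)
    where
    lemma : ∀ x y → x ℤ.+ (y ℤ.- x) ≡ y
    lemma = solve-∀

  floor-unique : ∀ {v} k → ι k ≤ v → v < ι (k ℤ.+ + 1) → ⌊ v ⌋ ≡ k
  floor-unique {v} k k≤v v<k+1 = ℤ.≤-antisym
    (below (≤-<-trans (floor-≤ v) v<k+1)) (below (≤-<-trans k≤v (<-floor v)))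
    where
    below : ∀ {x y} → ι x < ι (y ℤ.+ + 1) → x ℤ.≤ y
    below {x} {y} p with x ℤ.≤? y
    ... | yes x≤y = x≤y
    ... | no  x≰y = ⊥-elim (irrefl refl (≤-<-trans
          (ι-mono (≡.subst (ℤ._≤ x) (ℤ.+-comm (+ 1) y) (ℤ.i<j⇒suc[i]≤j (ℤ.≰⇒> x≰y)))) p))

  γ-bracket : ∀ {n} (w : Permutation′ (suc n)) (x : Coords Carrier n) a d →
              ∃ λ S → Bracket (γ w x) (ι (+ suc (a ℕ.+ d))) (ι (+ suc a)) S S
  γ-bracket w x a zero    rewrite ℕ.+-identityʳ a = 0# , end
  γ-bracket {n} w x a (suc d) rewrite ℕ.+-suc a d with γ-bracket w x (suc a) d
  ... | S , rest = _ , step {l = c} {u = c} a<a+1 constant rest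
    where
    c : Carrier
    c = valueAt w x (index n (+ suc a)) (index n (+ suc (suc a)))

    1+ : ∀ k → ι (+ k ℤ.+ + 1) ≈ ι (+ suc k)
    1+ k = reflexive (≡.cong (λ m → ι (+ m)) (ℕ.+-comm k 1))

    a<a+1 : ι (+ suc a) < ι (+ suc (suc a))
    a<a+1 = <-respʳ-≈ (+-comm _ _) (x<x+1 _)

    constant : ∀ v → ι (+ suc a) < v → v < ι (+ suc (suc a)) → c ≤ γ w x v × γ w x v ≤ c
    constant v a<v v<a+1 = inj₂ (sym eq) , inj₂ eq
      where
      ⌊v⌋ : ⌊ v ⌋ ≡ + suc a
      ⌊v⌋ = floor-unique (+ suc a) (inj₁ a<v) (<-respʳ-≈ (sym (1+ (suc a))) v<a+1)

      ⌊v+1⌋ : ⌊ v + 1# ⌋ ≡ + suc (suc a)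
      ⌊v+1⌋ = floor-unique (+ suc (suc a))
        (inj₁ (<-respˡ-≈ (+-comm _ _) (+-monoˡ-< 1# a<v)))
        (<-respʳ-≈ (trans (+-comm _ _) (sym (1+ (suc (suc a))))) (+-monoˡ-< 1# v<a+1))

      eq : γ w x v ≈ c
      eq = reflexive (≡.cong₂ (valueAt w x) (≡.cong (index n) ⌊v⌋) (≡.cong (index n) ⌊v+1⌋))

  -- Abstract, so that ∫ of γ is known only through IsIntegral.
  abstract
    γ-integrable : ∀ {n} (w : Permutation′ (suc n)) (x : Coords Carrier n) {i j : Fin (suc n)} →
                   i Fin.< j → Integrable (γ w x) (pos i) (pos j)
    γ-integrable w x {i} {j} i<j with γ-bracket w x (toℕ i) (toℕ j ℕ.∸ toℕ i)
    ... | S , bracket = S , λ ε 0<ε → S , S ,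
      ≡.subst (λ m → Bracket (γ w x) (ι (+ suc m)) (pos i) S S) (ℕ.m+[n∸m]≡n (ℕ.<⇒≤ i<j)) bracket ,
      <-respʳ-≈ (trans (+-assoc S ε (- ε)) (trans (+-congˡ (-‿inverseʳ ε)) (+-identityʳ S)))
        (+-monoˡ-< (- ε) (increase ε 0<ε)) ,
      increase ε 0<ε
      where
      increase : ∀ {S} ε → 0# < ε → S < S + ε
      increase {S} ε 0<ε = <-respˡ-≈ (+-identityˡ S) (<-respʳ-≈ (+-comm ε S) (+-monoˡ-< S 0<ε))

  prefix : ∀ {n} → (Fin n → ℤ) → Fin (suc n) → ℤ
  prefix         f zero    = + 0
  prefix {suc n} f (suc j) = f zero ℤ.+ prefix (f ∘ suc) j

  prefix-step : ∀ {n} (f : Fin n → ℤ) p → prefix f (suc p) ≡ prefix f (inject₁ p) ℤ.+ f p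
  prefix-step f zero    = ≡.trans (ℤ.+-identityʳ (f zero)) (≡.sym (ℤ.+-identityˡ (f zero)))
  prefix-step f (suc p) = ≡.trans (≡.cong (λ z → f zero ℤ.+ z) (prefix-step (f ∘ suc) p))
                                  (≡.sym (ℤ.+-assoc (f zero) _ _))

  filter-map : ∀ {A B : Set} {P : Pred B 0ℓ} {Q : Pred A 0ℓ} (P? : Decidable P) (Q? : Decidable Q)
               (f : A → B) → (∀ {x} → P (f x) → Q x) → (∀ {x} → Q x → P (f x)) →
               ∀ xs → filter P? (map f xs) ≡ map f (filter Q? xs)
  filter-map P? Q? f to from [] = ≡.refl
  filter-map P? Q? f to from (x ∷ xs) with P? (f x) | Q? x
  ... | yes p | yes q = ≡.cong (f x ∷_) (filter-map P? Q? f to from xs)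
  ... | no ¬p | no ¬q = filter-map P? Q? f to from xs
  ... | yes p | no ¬q = ⊥-elim (¬q (to p))
  ... | no ¬p | yes q = ⊥-elim (¬p (from q))

  tail-map : ∀ n → tabulate (Fin.suc {n}) ≡ map Fin.suc (allFin n)
  tail-map n = ≡.sym (map-tabulate (λ p → p) Fin.suc)

  interval-zero : ∀ {n} → interval {n} zero zero ≡ []
  interval-zero {n} = filter-none (between? zero zero) (universal (λ { _ (_ , ()) }) (allFin n))

  interval-first : ∀ {n} (j : Fin (suc n)) →
                   interval {suc n} zero (suc j) ≡ zero ∷ map suc (interval zero j)
  interval-first {n} j = ≡.cong (zero ∷_) (≡.trans (≡.cong (filter (between? zero (suc j))) (tail-map n))
    (filter-map (between? zero (suc j)) (between? zero j) suc (λ { (_ , s≤s q) → z≤n , q }) (λ { (_ , q) → z≤n , s≤s q }) (allFin n)))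

  interval-rest : ∀ {n} (i j : Fin (suc n)) →
                  interval {suc n} (suc i) (suc j) ≡ map suc (interval i j)
  interval-rest {n} i j = ≡.trans (≡.cong (filter (between? (suc i) (suc j))) (tail-map n))
    (filter-map (between? (suc i) (suc j)) (between? i j) suc (λ { (s≤s p , s≤s q) → p , q }) (λ { (p , q) → s≤s p , s≤s q }) (allFin n))

  ∑-cong : ∀ {A : Set} {f g : A → Carrier} → (∀ p → f p ≈ g p) → ∀ ps → ∑ ps f ≈ ∑ ps g
  ∑-cong f≈g []       = refl
  ∑-cong f≈g (p ∷ ps) = +-cong (f≈g p) (∑-cong f≈g ps)

  ∑-map : ∀ {A B : Set} (g : A → B) (f : B → Carrier) ps → ∑ (map g ps) f ≡ ∑ ps (f ∘ g)
  ∑-map g f []       = ≡.refl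
  ∑-map g f (p ∷ ps) = ≡.cong (λ s → f (g p) + s) (∑-map g f ps)

  add-differences : ∀ a b c → (a - b) + (c - a) ≈ c - b
  add-differences a b c = begin
    (a - b) + (c - a) ≈⟨ CM.solve 4 (λ a b c d → ((a CM.⊕ b) CM.⊕ (c CM.⊕ d)) CM.⊜ ((c CM.⊕ b) CM.⊕ (a CM.⊕ d))) refl a (- b) c (- a) ⟩
    (c - b) + (a - a) ≈⟨ +-congˡ (-‿inverseʳ a) ⟩
    (c - b) + 0#      ≈⟨ +-identityʳ _ ⟩
    c - b             ∎

  telescope : ∀ {n} (h : Fin (suc n) → Carrier) {i j} → i Fin.≤ j →
              ∑ (interval i j) (λ p → h (suc p) - h (inject₁ p)) ≈ h j - h i
  telescope {n} h {zero} {zero} _ rewrite interval-zero {n} = sym (-‿inverseʳ (h zero))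
  telescope {suc n} h {zero} {suc j} _ = begin
    ∑ (interval zero (suc j)) Δ
      ≡⟨ ≡.cong (λ ps → ∑ ps Δ) (interval-first j) ⟩
    (h (suc zero) - h zero) + ∑ (map suc (interval zero j)) Δ
      ≡⟨ ≡.cong (λ s → (h (suc zero) - h zero) + s) (∑-map suc Δ (interval zero j)) ⟩
    (h (suc zero) - h zero) + ∑ (interval zero j) (Δ ∘ suc)
      ≈⟨ +-congˡ (telescope (h ∘ suc) {zero} {j} z≤n) ⟩
    (h (suc zero) - h zero) + (h (suc j) - h (suc zero))
      ≈⟨ add-differences _ _ _ ⟩
    h (suc j) - h zero ∎
    where
    Δ : Fin (suc n) → Carrier
    Δ p = h (suc p) - h (inject₁ p)
  telescope {suc n} h {suc i} {suc j} (s≤s i≤j) = begin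
    ∑ (interval (suc i) (suc j)) Δ   ≡⟨ ≡.cong (λ ps → ∑ ps Δ) (interval-rest i j) ⟩
    ∑ (map suc (interval i j)) Δ     ≡⟨ ∑-map suc Δ (interval i j) ⟩
    ∑ (interval i j) (Δ ∘ suc)               ≈⟨ telescope (h ∘ suc) i≤j ⟩
    h (suc j) - h (suc i) ∎
    where
    Δ : Fin (suc n) → Carrier
    Δ p = h (suc p) - h (inject₁ p)

  prefixᴿ : ∀ {n} → (Fin n → Carrier) → Fin (suc n) → Carrier
  prefixᴿ         f zero    = 0#
  prefixᴿ {suc n} f (suc j) = f zero + prefixᴿ (f ∘ suc) j

  prefixᴿ-step : ∀ {n} (f : Fin n → Carrier) p → prefixᴿ f (suc p) ≈ prefixᴿ f (inject₁ p) + f p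
  prefixᴿ-step f zero    = trans (+-identityʳ _) (sym (+-identityˡ _))
  prefixᴿ-step f (suc p) = trans (+-congˡ (prefixᴿ-step (f ∘ suc) p)) (sym (+-assoc (f zero) _ _))

  Offset : ∀ {n} → Admitted n → (Fin (suc n) → Carrier) → Pred (Coords Carrier n) 0ℓ
  Offset lam h x = ∀ i j (i<j : i Fin.< j) → x i j i<j ≈ (h j - h i) + ι (entry lam i j i<j)

  X⇒Offset : ∀ {n} (lam : Admitted n) {x} → X[ lam ] x → ∃ λ h → Offset lam h x
  X⇒Offset lam {x} x∈X = h , λ i j i<j → trans (x∈X i j i<j)
    (+-congʳ (trans (∑-cong difference (interval i j)) (telescope h (ℕ.<⇒≤ i<j))))
    where
    f = λ p → x (inject₁ p) (suc p) (p<p+1 p)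
    h = prefixᴿ f

    difference : ∀ p → f p ≈ h (suc p) - h (inject₁ p)
    difference p = begin
      f p                                      ≈⟨ +-identityʳ _ ⟨
      f p + 0#                                 ≈⟨ +-congˡ (-‿inverseʳ _) ⟨
      f p + (h (inject₁ p) - h (inject₁ p))    ≈⟨ +-assoc _ _ _ ⟨
      f p + h (inject₁ p) - h (inject₁ p)      ≈⟨ +-congʳ (trans (prefixᴿ-step f p) (+-comm _ _)) ⟨
      h (suc p) - h (inject₁ p)                ∎

  Offset⇒X : ∀ {n} (lam : Admitted n) {h x} → Offset lam h x → X[ lam ] x
  Offset⇒X lam {h} {x} x∈O i j i<j = trans (x∈O i j i<j)
    (+-congʳ (sym (trans (∑-cong difference (interval i j)) (telescope h (ℕ.<⇒≤ i<j)))))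
    where
    difference : ∀ p → x (inject₁ p) (suc p) (p<p+1 p) ≈ h (suc p) - h (inject₁ p)
    difference p = trans (x∈O _ _ (p<p+1 p))
      (trans (+-congˡ (reflexive (≡.cong ι (simple lam p)))) (+-identityʳ _))

  Fᶻ : ∀ {n} → Permutation′ (suc n) → Coords ℤ n → Coords ℤ n
  Fᶻ w x i j i<j with Fin.<-cmp (w ⟨$⟩ˡ i) (w ⟨$⟩ˡ j)
  ... | tri< a<b _ _ = x (w ⟨$⟩ˡ i) (w ⟨$⟩ˡ j) a<b
  ... | tri≈ _ a≡b _ = ⊥-elim-irr (Fin.<⇒≢ i<j (injective w a≡b))
  ... | tri> _ _ b<a = ℤ.- x (w ⟨$⟩ˡ j) (w ⟨$⟩ˡ i) b<a ℤ.- + 1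

  F-offset : ∀ {n} (w : Permutation′ (suc n)) (lam : Admitted n) {h x} → Offset lam h x →
             ∀ i j (i<j : i Fin.< j) →
             F w x i j i<j ≈ (h (w ⟨$⟩ˡ j) - h (w ⟨$⟩ˡ i)) + ι (Fᶻ w (entry lam) i j i<j)
  F-offset w lam {h} {x} x∈O i j i<j with Fin.<-cmp (w ⟨$⟩ˡ i) (w ⟨$⟩ˡ j)
  ... | tri< a<b _ _ = x∈O _ _ a<b
  ... | tri≈ _ a≡b _ = ⊥-elim (Fin.<⇒≢ i<j (injective w a≡b))
  ... | tri> _ _ b<a = begin
    - x b a b<a - 1#                            ≈⟨ +-congʳ (-‿cong (x∈O _ _ b<a)) ⟩
    - ((h a - h b) + ι u) - 1#                  ≈⟨ +-congʳ (-‿+-comm _ _) ⟨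
    - (h a - h b) - ι u - 1#                    ≈⟨ +-congʳ (+-congʳ (-‿+-comm _ _)) ⟨
    - h a - (- h b) - ι u - 1#                  ≈⟨ +-congʳ (+-congʳ (trans (+-congˡ (-‿involutive _)) (+-comm _ _))) ⟩
    h b - h a - ι u - 1#                        ≈⟨ +-assoc _ _ _ ⟩
    h b - h a + (- ι u - 1#)                    ≈⟨ +-congˡ (+-cong (ι-neg u) (-‿cong (+-identityʳ 1#))) ⟨
    h b - h a + (ι (ℤ.- u) - ι (+ 1))           ≈⟨ +-congˡ (ι-minus (ℤ.- u) (+ 1)) ⟨
    h b - h a + ι (ℤ.- u ℤ.- + 1)               ∎
    where
    a = w ⟨$⟩ˡ i
    b = w ⟨$⟩ˡ j
    u = entry lam b a b<a

  ≤-by-difference : ∀ {p q u v} → p ℤ.≤ q → v ℤ.- u ≡ q ℤ.- p → u ℤ.≤ v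
  ≤-by-difference p≤q eq = ℤ.0≤i-j⇒j≤i (≡.subst (+ 0 ℤ.≤_) (≡.sym eq) (ℤ.i≤j⇒0≤j-i p≤q))

  pulled : ∀ {n} (w : Permutation′ (suc n)) → Admitted n → (i j : Fin (suc n)) →
           .((w ⟨$⟩ˡ i) Fin.< (w ⟨$⟩ˡ j)) → ℤ
  pulled w lam i j = entry lam (w ⟨$⟩ˡ i) (w ⟨$⟩ˡ j)

  Fᶻ-admitted : ∀ {n} (w : Permutation′ (suc n)) (lam : Admitted n) {i j k} (i<j : i Fin.< j) (j<k : j Fin.< k) →
             let y = Fᶻ w (entry lam) in
             y i j i<j ℤ.+ y j k j<k ℤ.≤ y i k (Fin.<-trans i<j j<k) ×
             y i k (Fin.<-trans i<j j<k) ℤ.≤ y i j i<j ℤ.+ y j k j<k ℤ.+ + 1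
  Fᶻ-admitted w lam {i} {j} {k} i<j j<k
    with Fin.<-cmp (w ⟨$⟩ˡ i) (w ⟨$⟩ˡ j) | Fin.<-cmp (w ⟨$⟩ˡ j) (w ⟨$⟩ˡ k) | Fin.<-cmp (w ⟨$⟩ˡ i) (w ⟨$⟩ˡ k)
  ... | tri≈ _ a≡b _ | _ | _ = ⊥-elim (Fin.<⇒≢ i<j (injective w a≡b))
  ... | tri< _ _ _ | tri≈ _ b≡c _ | _ = ⊥-elim (Fin.<⇒≢ j<k (injective w b≡c))
  ... | tri> _ _ _ | tri≈ _ b≡c _ | _ = ⊥-elim (Fin.<⇒≢ j<k (injective w b≡c))
  ... | tri< _ _ _ | tri< _ _ _ | tri≈ _ a≡c _ = ⊥-elim (Fin.<⇒≢ (Fin.<-trans i<j j<k) (injective w a≡c))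
  ... | tri< _ _ _ | tri> _ _ _ | tri≈ _ a≡c _ = ⊥-elim (Fin.<⇒≢ (Fin.<-trans i<j j<k) (injective w a≡c))
  ... | tri> _ _ _ | tri< _ _ _ | tri≈ _ a≡c _ = ⊥-elim (Fin.<⇒≢ (Fin.<-trans i<j j<k) (injective w a≡c))
  ... | tri> _ _ _ | tri> _ _ _ | tri≈ _ a≡c _ = ⊥-elim (Fin.<⇒≢ (Fin.<-trans i<j j<k) (injective w a≡c))
  ... | tri< a<b _ _ | tri< b<c _ _ | tri> ¬a<c _ _ = ⊥-elim (¬a<c (Fin.<-trans a<b b<c))
  ... | tri> _ _ b<a | tri> _ _ c<b | tri< _ _ ¬c<a = ⊥-elim (¬c<a (Fin.<-trans c<b b<a))
  ... | tri< a<b _ _ | tri< b<c _ _ | tri< a<c _ _ = lower lam a<b b<c , upper lam a<b b<c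
  ... | tri> _ _ b<a | tri> _ _ c<b | tri> _ _ c<a =
    ≤-by-difference (upper lam c<b b<a) (eq₁ (pulled w lam k j c<b) (pulled w lam j i b<a) (pulled w lam k i c<a)) ,
    ≤-by-difference (lower lam c<b b<a) (eq₂ (pulled w lam k j c<b) (pulled w lam j i b<a) (pulled w lam k i c<a))
    where
    eq₁ : ∀ x y z → (ℤ.- z ℤ.- + 1) ℤ.- ((ℤ.- y ℤ.- + 1) ℤ.+ (ℤ.- x ℤ.- + 1)) ≡ (x ℤ.+ y ℤ.+ + 1) ℤ.- z
    eq₁ = solve-∀
    eq₂ : ∀ x y z → ((ℤ.- y ℤ.- + 1) ℤ.+ (ℤ.- x ℤ.- + 1) ℤ.+ + 1) ℤ.- (ℤ.- z ℤ.- + 1) ≡ z ℤ.- (x ℤ.+ y)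
    eq₂ = solve-∀
  ... | tri< a<b _ _ | tri> _ _ c<b | tri< a<c _ _ =
    ≤-by-difference (upper lam a<c c<b) (eq₁ (pulled w lam i k a<c) (pulled w lam k j c<b) (pulled w lam i j a<b)) ,
    ≤-by-difference (lower lam a<c c<b) (eq₂ (pulled w lam i k a<c) (pulled w lam k j c<b) (pulled w lam i j a<b))
    where
    eq₁ : ∀ ac cb ab → ac ℤ.- (ab ℤ.+ (ℤ.- cb ℤ.- + 1)) ≡ (ac ℤ.+ cb ℤ.+ + 1) ℤ.- ab
    eq₁ = solve-∀
    eq₂ : ∀ ac cb ab → (ab ℤ.+ (ℤ.- cb ℤ.- + 1) ℤ.+ + 1) ℤ.- ac ≡ ab ℤ.- (ac ℤ.+ cb)
    eq₂ = solve-∀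
  ... | tri< a<b _ _ | tri> _ _ c<b | tri> _ _ c<a =
    ≤-by-difference (lower lam c<a a<b) (eq₁ (pulled w lam k i c<a) (pulled w lam i j a<b) (pulled w lam k j c<b)) ,
    ≤-by-difference (upper lam c<a a<b) (eq₂ (pulled w lam k i c<a) (pulled w lam i j a<b) (pulled w lam k j c<b))
    where
    eq₁ : ∀ ca ab cb → (ℤ.- ca ℤ.- + 1) ℤ.- (ab ℤ.+ (ℤ.- cb ℤ.- + 1)) ≡ cb ℤ.- (ca ℤ.+ ab)
    eq₁ = solve-∀
    eq₂ : ∀ ca ab cb → (ab ℤ.+ (ℤ.- cb ℤ.- + 1) ℤ.+ + 1) ℤ.- (ℤ.- ca ℤ.- + 1) ≡ (ca ℤ.+ ab ℤ.+ + 1) ℤ.- cb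
    eq₂ = solve-∀
  ... | tri> _ _ b<a | tri< b<c _ _ | tri< a<c _ _ =
    ≤-by-difference (upper lam b<a a<c) (eq₁ (pulled w lam j i b<a) (pulled w lam i k a<c) (pulled w lam j k b<c)) ,
    ≤-by-difference (lower lam b<a a<c) (eq₂ (pulled w lam j i b<a) (pulled w lam i k a<c) (pulled w lam j k b<c))
    where
    eq₁ : ∀ ba ac bc → ac ℤ.- ((ℤ.- ba ℤ.- + 1) ℤ.+ bc) ≡ (ba ℤ.+ ac ℤ.+ + 1) ℤ.- bc
    eq₁ = solve-∀
    eq₂ : ∀ ba ac bc → ((ℤ.- ba ℤ.- + 1) ℤ.+ bc ℤ.+ + 1) ℤ.- ac ≡ bc ℤ.- (ba ℤ.+ ac)
    eq₂ = solve-∀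
  ... | tri> _ _ b<a | tri< b<c _ _ | tri> _ _ c<a =
    ≤-by-difference (lower lam b<c c<a) (eq₁ (pulled w lam j k b<c) (pulled w lam k i c<a) (pulled w lam j i b<a)) ,
    ≤-by-difference (upper lam b<c c<a) (eq₂ (pulled w lam j k b<c) (pulled w lam k i c<a) (pulled w lam j i b<a))
    where
    eq₁ : ∀ bc ca ba → (ℤ.- ca ℤ.- + 1) ℤ.- ((ℤ.- ba ℤ.- + 1) ℤ.+ bc) ≡ ba ℤ.- (bc ℤ.+ ca)
    eq₁ = solve-∀
    eq₂ : ∀ bc ca ba → ((ℤ.- ba ℤ.- + 1) ℤ.+ bc ℤ.+ + 1) ℤ.- (ℤ.- ca ℤ.- + 1) ≡ (bc ℤ.+ ca ℤ.+ + 1) ℤ.- ba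
    eq₂ = solve-∀

  add-offsets : ∀ a b c d m → (a - b) + ((c - d) + m) ≈ ((a + c) - (b + d)) + m
  add-offsets a b c d m = begin
    (a - b) + ((c - d) + m)     ≈⟨ CM.solve 5 (λ a b c d m → ((a CM.⊕ b) CM.⊕ ((c CM.⊕ d) CM.⊕ m)) CM.⊜ (((a CM.⊕ c) CM.⊕ (b CM.⊕ d)) CM.⊕ m)) refl a (- b) c (- d) m ⟩
    ((a + c) + (- b - d)) + m   ≈⟨ +-congʳ (+-congˡ (-‿+-comm b d)) ⟩
    ((a + c) - (b + d)) + m     ∎

  -- Abstract, so that w ⋄ lam is known only through its defining property
  -- ⋄-spec, which determines it since lam ∈ X[ lam ].
  abstract
    ⋄-exists : ∀ {n} (w : Permutation′ (suc n)) (lam : Admitted n) →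
               ∃ λ (μ : Admitted n) → Image (F w) X[ lam ] ≐ X[ μ ]
    ⋄-exists {n} w lam = μ , to , from
      where
      y : Coords ℤ n
      y = Fᶻ w (entry lam)

      f : Fin n → ℤ
      f p = y (inject₁ p) (suc p) (p<p+1 p)

      g : Fin (suc n) → ℤ
      g = prefix f

      μ : Admitted n
      μ .entry i j i<j = y i j i<j ℤ.- (g j ℤ.- g i)
      μ .simple p = ≡.trans (≡.cong (λ z → f p ℤ.- (z ℤ.- g (inject₁ p))) (prefix-step f p)) (eq (f p) (g (inject₁ p)))
        where
        eq : ∀ a b → a ℤ.- (b ℤ.+ a ℤ.- b) ≡ + 0
        eq = solve-∀
      μ .lower {i} {j} {k} i<j j<k = ≤-by-difference (proj₁ (Fᶻ-admitted w lam i<j j<k)) 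
        (eq (y i j i<j) (y j k j<k) (y i k (Fin.<-trans i<j j<k)) (g i) (g j) (g k))
        where
        eq : ∀ ij jk ik a b c → (ik ℤ.- (c ℤ.- a)) ℤ.- ((ij ℤ.- (b ℤ.- a)) ℤ.+ (jk ℤ.- (c ℤ.- b))) ≡ ik ℤ.- (ij ℤ.+ jk)
        eq = solve-∀
      μ .upper {i} {j} {k} i<j j<k = ≤-by-difference (proj₂ (Fᶻ-admitted w lam i<j j<k)) 
        (eq (y i j i<j) (y j k j<k) (y i k (Fin.<-trans i<j j<k)) (g i) (g j) (g k))
        where
        eq : ∀ ij jk ik a b c → ((ij ℤ.- (b ℤ.- a)) ℤ.+ (jk ℤ.- (c ℤ.- b)) ℤ.+ + 1) ℤ.- (ik ℤ.- (c ℤ.- a)) ≡ (ij ℤ.+ jk ℤ.+ + 1) ℤ.- ik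
        eq = solve-∀

      G : Fin (suc n) → Carrier
      G i = ι (g i)

      y-offset : ∀ i j (i<j : i Fin.< j) → ι (y i j i<j) ≈ (G j - G i) + ι (entry μ i j i<j)
      y-offset i j i<j = begin
        ι (y i j i<j)                                ≡⟨ ≡.cong ι (eq (y i j i<j) (g j ℤ.- g i)) ⟩
        ι ((g j ℤ.- g i) ℤ.+ entry μ i j i<j)        ≈⟨ ι-+ (g j ℤ.- g i) _ ⟩
        ι (g j ℤ.- g i) + ι (entry μ i j i<j)        ≈⟨ +-congʳ (ι-minus (g j) (g i)) ⟩
        (G j - G i) + ι (entry μ i j i<j)            ∎
        where
        eq : ∀ a b → a ≡ b ℤ.+ (a ℤ.- b)
        eq = solve-∀

      F-offset′ : ∀ {h x} → Offset lam h x → Offset μ (λ i → h (w ⟨$⟩ˡ i) + G i) (F w x)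
      F-offset′ {h} {x} x∈O i j i<j = begin
        F w x i j i<j                                                         ≈⟨ F-offset w lam {h} {x} x∈O i j i<j ⟩
        (h (w ⟨$⟩ˡ j) - h (w ⟨$⟩ˡ i)) + ι (y i j i<j)                           ≈⟨ +-congˡ (y-offset i j i<j) ⟩
        (h (w ⟨$⟩ˡ j) - h (w ⟨$⟩ˡ i)) + ((G j - G i) + ι (entry μ i j i<j))      ≈⟨ add-offsets _ _ _ _ _ ⟩
        ((h (w ⟨$⟩ˡ j) + G j) - (h (w ⟨$⟩ˡ i) + G i)) + ι (entry μ i j i<j)      ∎

      to : ∀ {z} → Image (F w) X[ lam ] z → X[ μ ] z
      to {z} (x , x∈X , z≈Fx) with X⇒Offset lam {x} x∈X
      ... | h , x∈O = Offset⇒X μ {x = z} λ i j i<j → trans (z≈Fx i j i<j) (F-offset′ {h} {x} x∈O i j i<j)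

      from : ∀ {z} → X[ μ ] z → Image (F w) X[ lam ] z
      from {z} z∈X with X⇒Offset μ {z} z∈X
      ... | h , z∈O = x , Offset⇒X lam {x = x} x∈O , λ i j i<j → begin
        z i j i<j                                                              ≈⟨ z∈O i j i<j ⟩
        (h j - h i) + ι (entry μ i j i<j)                                      ≈⟨ +-congʳ (+-cong (back j) (-‿cong (back i))) ⟨
        ((k (w ⟨$⟩ˡ j) + G j) - (k (w ⟨$⟩ˡ i) + G i)) + ι (entry μ i j i<j)      ≈⟨ F-offset′ {k} {x} x∈O i j i<j ⟨
        F w x i j i<j                                                          ∎
        where
        k : Fin (suc n) → Carrier
        k a = h (w ⟨$⟩ʳ a) - G (w ⟨$⟩ʳ a)

        x : Coords Carrier n
        x i j i<j = (k j - k i) + ι (entry lam i j i<j)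

        x∈O : Offset lam k x
        x∈O i j i<j = refl

        back : ∀ i → k (w ⟨$⟩ˡ i) + G i ≈ h i
        back i = begin
          k (w ⟨$⟩ˡ i) + G i   ≡⟨ ≡.cong (λ a → h a - G a + G i) (inverseʳ w) ⟩
          h i - G i + G i     ≈⟨ +-assoc _ _ _ ⟩
          h i + (- G i + G i) ≈⟨ +-congˡ (-‿inverseˡ _) ⟩
          h i + 0#            ≈⟨ +-identityʳ _ ⟩
          h i                 ∎

  infixr 7 _⋄_
  _⋄_ : ∀ {n} → Permutation′ (suc n) → Admitted n → Admitted n
  w ⋄ lam = proj₁ (⋄-exists w lam)

  ⋄-spec : ∀ {n} (w : Permutation′ (suc n)) (lam : Admitted n) →
           Image (F w) X[ lam ] ≐ X[ w ⋄ lam ]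
  ⋄-spec w lam = proj₂ (⋄-exists w lam)

open Reals ⦃...⦄ public using (_≈_; _+_; _-_; 1#; ι)
open OverReals ⦃...⦄ public

{-# OPTIONS --safe #-}

-- λ is itself a point of X[λ], with all simple coordinates 0, so F(t)(λ) lies
-- in X[t ⋄ λ] and (t ⋄ λ)_{i,j} is F(t)(λ)_{i,j} minus the sum of the simple
-- coordinates of F(t)(λ) between i and j.  F(t)(λ)_{a,b} is λ_{t(a),t(b)},
-- less 1 when e_a − e_b ∈ N(t); hence that sum is ∑ λ_{t(p),t(p+1)} − |B|, and
-- ∑ λ_{t(p),t(p+1)} is the integral of the step function γ_t(λ,·).
module Submission where

open import Defs using (Reals; Coords; Admitted; entry; interval; index; p<p+1; module OverReals)
open import Data.Bool.Base using (if_then_else_; true; false)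
open import Data.Empty using (⊥-elim)
open import Data.Fin.Base as Fin using (Fin; suc; toℕ; inject₁; fromℕ)
open import Data.Fin.Induction using (>-weakInduction)
open import Data.Fin.Permutation using (Permutation′; transpose; _⟨$⟩ʳ_; _⟨$⟩ˡ_; flip; inverseˡ; inverseʳ)
import Data.Fin.Properties as Fin
open import Data.Integer.Base using (+_)
open import Data.List.Base using ([]; _∷_; length; filter)
open import Data.Maybe.Base using (just)
open import Data.Nat.Base as ℕ using (ℕ; suc)
import Data.Nat.Properties as ℕ
open import Data.Product.Base using (∃; _×_; _,_; proj₁; proj₂)
open import Data.Sum.Base using (inj₁; inj₂)
open import Function.Base using (_∘_)
open import Function.Bundles using (mk⇔)
open import Level using (0ℓ)
open import Relation.Binary.Definitions using (tri<; tri≈; tri>)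
open import Relation.Binary.PropositionalEquality.Core as ≡ using (_≡_; _≢_)
open import Relation.Binary.Structures using (IsStrictTotalOrder)
open import Relation.Nullary using (¬_; yes; no; does)
open import Relation.Nullary.Decidable using (dec-true; dec-false; does-⇔)
open import Relation.Unary using (Pred; Decidable)

-- `F` permutes indices by `t ⟨$⟩ˡ_`, `γ` by `t ⟨$⟩ʳ_`; for `t = transpose k l` the former unfolds
-- to `transpose l k ⟨$⟩ʳ_`. The two sides test `m` against `k` and `l` in opposite orders.
transpose-comm : ∀ {n} {k l : Fin n} → k ≢ l → ∀ m →
                 transpose l k ⟨$⟩ʳ m ≡ transpose k l ⟨$⟩ʳ m
transpose-comm {k = k} {l} k≢l m with m Fin.≟ k in eq
... | yes m≡k rewrite dec-false (m Fin.≟ l) (k≢l ∘ ≡.trans (≡.sym m≡k)) | eq = ≡.refl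
... | no _ with does (m Fin.≟ l)
...   | true = ≡.refl
...   | false rewrite eq = ≡.refl

index-toℕ : ∀ {n} (i : Fin (suc n)) → index n (+ suc (toℕ i)) ≡ just i
index-toℕ {n} i with toℕ i ℕ.<? suc n
... | yes i<1+n = ≡.cong just (Fin.fromℕ<-toℕ i i<1+n)
... | no  i≮1+n = ⊥-elim (i≮1+n (Fin.toℕ<n i))

module _ (ℝ : Reals) where
  open Reals ℝ
  open OverReals ⦃ ℝ ⦄
  open IsStrictTotalOrder isStrictTotalOrder
    using (compare; irrefl; asym; <-respˡ-≈; <-respʳ-≈) renaming (trans to <-trans)
  open import Algebra.Properties.AbelianGroup +-abelianGroup
    using () renaming (⁻¹-anti-homo‿- to -‿anti-homo; ⁻¹-∙-comm to -‿+-comm;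
                       //-rightDividesˡ to x-y+y≈x; ⁻¹-involutive to -‿involutive; ε⁻¹≈ε to -0≈0)
  open import Algebra.Properties.Ring ring using ([y-z]x≈yx-zx)
  import Algebra.Solver.CommutativeMonoid +-commutativeMonoid as CM
  open import Relation.Binary.Reasoning.Setoid setoid

  -- Order and density in an ordered field

  ≤⇒≯ : ∀ {x y} → x ≤ y → ¬ y < x
  ≤⇒≯ x≤y y<x = irrefl refl (≤-<-trans x≤y y<x)

  +-monoˡ-≤ : ∀ z {x y} → x ≤ y → x + z ≤ y + z
  +-monoˡ-≤ z (inj₁ x<y) = inj₁ (+-monoˡ-< z x<y)
  +-monoˡ-≤ z (inj₂ x≈y) = inj₂ (+-congʳ x≈y)

  +-mono-≤ : ∀ {x y u v} → x ≤ y → u ≤ v → x + u ≤ y + v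
  +-mono-≤ {x} {y} {u} {v} x≤y u≤v = ≤-trans (+-monoˡ-≤ u x≤y)
    (≤-trans (inj₂ (+-comm y u)) (≤-trans (+-monoˡ-≤ y u≤v) (inj₂ (+-comm v y))))

  x<y⇒0<y-x : ∀ {x y} → x < y → 0# < y - x
  x<y⇒0<y-x {x} x<y = <-respˡ-≈ (-‿inverseʳ x) (+-monoˡ-< (- x) x<y)

  0<y-x⇒x<y : ∀ {x y} → 0# < y - x → x < y
  0<y-x⇒x<y {x} {y} 0<y-x =
    <-respˡ-≈ (+-identityˡ x) (<-respʳ-≈ (x-y+y≈x x y) (+-monoˡ-< x 0<y-x))

  *-monoʳ-≤ : ∀ {x y z} → 0# < z → x ≤ y → x * z ≤ y * z
  *-monoʳ-≤ {x} {y} {z} 0<z (inj₁ x<y) =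
    inj₁ (0<y-x⇒x<y (<-respʳ-≈ ([y-z]x≈yx-zx z y x) (*-pos (x<y⇒0<y-x x<y) 0<z)))
  *-monoʳ-≤ 0<z (inj₂ x≈y) = inj₂ (*-congʳ x≈y)

  x<x+y : ∀ x {y} → 0# < y → x < x + y
  x<x+y x {y} 0<y = <-respˡ-≈ (+-identityˡ x) (<-respʳ-≈ (+-comm y x) (+-monoˡ-< x 0<y))

  half : ∃ λ h → 0# < h × h + h ≈ 1#
  half = h , 0<h , h+h≈1
    where
    0<2 : 0# < 1# + 1#
    0<2 = <-trans 0<1 (x<x+1 1#)

    inverse-of-2 : ∃ λ h → (1# + 1#) * h ≈ 1#
    inverse-of-2 = inverse (1# + 1#) λ 2≈0 → irrefl (sym 2≈0) 0<2

    h : Carrier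
    h = proj₁ inverse-of-2

    h+h≈1 : h + h ≈ 1#
    h+h≈1 = begin
      h + h            ≈⟨ +-cong (*-identityˡ h) (*-identityˡ h) ⟨
      1# * h + 1# * h  ≈⟨ distribʳ h 1# 1# ⟨
      (1# + 1#) * h    ≈⟨ proj₂ inverse-of-2 ⟩
      1#               ∎

    0<h : 0# < h
    0<h with compare 0# h
    ... | tri< 0<h _ _ = 0<h
    ... | tri≈ _ 0≈h _ = ⊥-elim (irrefl (trans (sym (+-identityˡ 0#)) (trans (+-cong 0≈h 0≈h) h+h≈1)) 0<1)
    ... | tri> _ _ h<0 = ⊥-elim (asym 0<1 (<-respˡ-≈ h+h≈1
            (<-trans (<-respʳ-≈ (+-identityˡ h) (+-monoˡ-< h h<0)) h<0)))

  -- A `Bracket` bounds `f` only inside its open pieces, so comparing two bounds takes an interior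
  -- point; the midpoint serves.
  dense : ∀ {x y} → x < y → ∃ λ v → x < v × v < y
  dense {x} {y} x<y with half
  ... | h , 0<h , h+h≈1 = x + s , x<x+y x 0<s , <-respʳ-≈ x+s+s≈y (x<x+y (x + s) 0<s)
    where
    s : Carrier
    s = (y - x) * h

    0<s : 0# < s
    0<s = *-pos (x<y⇒0<y-x x<y) 0<h

    x+s+s≈y : x + s + s ≈ y
    x+s+s≈y = begin
      x + s + s              ≈⟨ +-assoc x s s ⟩
      x + (s + s)            ≈⟨ +-congˡ (distribˡ (y - x) h h) ⟨
      x + (y - x) * (h + h)  ≈⟨ +-congˡ (*-congˡ h+h≈1) ⟩
      x + (y - x) * 1#       ≈⟨ +-congˡ (*-identityʳ (y - x)) ⟩
      x + (y - x)            ≈⟨ +-comm x (y - x) ⟩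
      y - x + x              ≈⟨ x-y+y≈x x y ⟩
      y                      ∎

  -- The Darboux integral

  -- Excludes the cases where one subdivision ends at `b` and the other would have to run past it.
  bracket⇒≤ : ∀ {f a b L U} → Bracket f b a L U → a ≤ b
  bracket⇒≤ end                = inj₂ refl
  bracket⇒≤ (step a<c _ rest)  = ≤-trans (inj₁ a<c) (bracket⇒≤ rest)

  -- The value of `f` at a point of (a , c) lies above `l` and below `u`. The bound `u` may come
  -- from a longer piece, as happens in a common refinement.
  bound-on-piece : ∀ {f : Carrier → Carrier} {a c d l u} → a < c → c ≤ d →
                   (∀ v → a < v → v < c → l ≤ f v) → (∀ v → a < v → v < d → f v ≤ u) →
                   l * (c - a) ≤ u * (c - a)
  bound-on-piece a<c c≤d l≤f f≤u with dense a<c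
  ... | v , a<v , v<c = *-monoʳ-≤ (x<y⇒0<y-x a<c)
          (≤-trans (l≤f v a<v v<c) (f≤u v a<v (<-≤-trans v<c c≤d)))
    where
    <-≤-trans : ∀ {x y z} → x < y → y ≤ z → x < z
    <-≤-trans p (inj₁ q) = <-trans p q
    <-≤-trans p (inj₂ q) = <-respʳ-≈ q p

  -- Refinement invariance of Darboux sums: both parts of a piece cut at `c` inherit its bound. It
  -- serves lower and upper sums alike.
  split-piece : ∀ u a c d S → u * (c - a) + (u * (d - c) + S) ≈ u * (d - a) + S
  split-piece u a c d S = begin
    u * (c - a) + (u * (d - c) + S)  ≈⟨ +-assoc _ _ _ ⟨
    u * (c - a) + u * (d - c) + S    ≈⟨ +-congʳ (distribˡ u (c - a) (d - c)) ⟨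
    u * ((c - a) + (d - c)) + S      ≈⟨ +-congʳ (*-congˡ (add-differences c a d)) ⟩
    u * (d - a) + S                  ∎

  -- The Darboux inequality, which pins down the integral. The left ends are related by `≈` because
  -- `compare` yields only `c₁ ≈ c₂`, while the indices of `Bracket` are fixed up to `≡`.
  lower≤upper : ∀ {f b a₁ a₂ L₁ U₁ L₂ U₂} →
                Bracket f b a₁ L₁ U₁ → Bracket f b a₂ L₂ U₂ → a₁ ≈ a₂ → L₁ ≤ U₂

  -- Walks along the common refinement of two subdivisions: the first pieces
  -- (a , c₁) and (a , c₂) are kept apart from the rest so that the longer one
  -- can be cut at the end of the shorter.
  lower≤upper-step : ∀ {f b a c₁ c₂ l u L₁ U₁ L₂ U₂} →
    a < c₁ → (∀ v → a < v → v < c₁ → l ≤ f v) → Bracket f b c₁ L₁ U₁ →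
    a < c₂ → (∀ v → a < v → v < c₂ → f v ≤ u) → Bracket f b c₂ L₂ U₂ →
    l * (c₁ - a) + L₁ ≤ u * (c₂ - a) + U₂
  lower≤upper-step {c₁ = c₁} {c₂} a<c₁ l≤f rest₁ a<c₂ f≤u rest₂ with compare c₁ c₂
  lower≤upper-step _ _ end _ _ rest₂ | tri< c₁<c₂ _ _ = ⊥-elim (≤⇒≯ (bracket⇒≤ rest₂) c₁<c₂)
  lower≤upper-step {a = a} {c₁} {c₂} {u = u} a<c₁ l≤f (step c₁<d bounds rest₁) a<c₂ f≤u rest₂ | tri< c₁<c₂ _ _ =
    ≤-trans
      (+-mono-≤ (bound-on-piece a<c₁ (inj₁ c₁<c₂) l≤f f≤u)
        (lower≤upper-step c₁<d (λ v p q → proj₁ (bounds v p q)) rest₁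
          c₁<c₂ (λ v p q → f≤u v (<-trans a<c₁ p) q) rest₂))
      (inj₂ (split-piece u a c₁ c₂ _))
  lower≤upper-step _ _ rest₁ _ _ end | tri> _ _ c₂<c₁ = ⊥-elim (≤⇒≯ (bracket⇒≤ rest₁) c₂<c₁)
  lower≤upper-step {a = a} {c₁} {c₂} {l} a<c₁ l≤f rest₁ a<c₂ f≤u (step c₂<d bounds rest₂) | tri> _ _ c₂<c₁ =
    ≤-trans
      (inj₂ (sym (split-piece l a c₂ c₁ _)))
      (+-mono-≤ (bound-on-piece a<c₂ (inj₂ refl) (λ v p q → l≤f v p (<-trans q c₂<c₁)) f≤u)
        (lower≤upper-step c₂<c₁ (λ v p q → l≤f v (<-trans a<c₂ p) q) rest₁
          c₂<d (λ v p q → proj₂ (bounds v p q)) rest₂))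
  lower≤upper-step a<c₁ l≤f rest₁ a<c₂ f≤u rest₂ | tri≈ _ c₁≈c₂ _ =
    +-mono-≤
      (≤-trans (bound-on-piece a<c₁ (inj₂ c₁≈c₂) l≤f f≤u) (inj₂ (*-congˡ (+-congʳ c₁≈c₂))))
      (lower≤upper rest₁ rest₂ c₁≈c₂)

  lower≤upper end end _ = inj₂ refl
  lower≤upper end (step c₂<d _ rest₂) c₁≈c₂ =
    ⊥-elim (≤⇒≯ (bracket⇒≤ rest₂) (<-respˡ-≈ (sym c₁≈c₂) c₂<d))
  lower≤upper (step c₁<d _ rest₁) end c₁≈c₂ =
    ⊥-elim (≤⇒≯ (bracket⇒≤ rest₁) (<-respˡ-≈ c₁≈c₂ c₁<d))
  lower≤upper (step c₁<d bounds₁ rest₁) (step c₂<d bounds₂ rest₂) c₁≈c₂ =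
    ≤-trans
      (lower≤upper-step c₁<d (λ v p q → proj₁ (bounds₁ v p q)) rest₁
        (<-respˡ-≈ (sym c₁≈c₂) c₂<d) (λ v p q → proj₂ (bounds₂ v (<-respˡ-≈ c₁≈c₂ p) q)) rest₂)
      (inj₂ (+-congʳ (*-congˡ (+-congˡ (-‿cong c₁≈c₂)))))

  -- Were `I` different from `S`, the tolerance |I - S| would give an upper sum below `S` or a lower
  -- sum above `S`, against `lower≤upper` with the exact bracket.
  exact-bracket⇒integral : ∀ {f a b I S} → IsIntegral f a b I → Bracket f b a S S → I ≈ S
  exact-bracket⇒integral {I = I} {S} isIntegral exact with compare I S
  ... | tri≈ _ I≈S _ = I≈S
  ... | tri< I<S _ _ with isIntegral (S - I) (x<y⇒0<y-x I<S)
  ...   | L , U , bracket , _ , U<I+ε = ⊥-elim (≤⇒≯ (lower≤upper exact bracket refl)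
          (<-respʳ-≈ (trans (+-comm I (S - I)) (x-y+y≈x I S)) U<I+ε))
  exact-bracket⇒integral {I = I} {S} isIntegral exact | tri> _ _ S<I
    with isIntegral (I - S) (x<y⇒0<y-x S<I)
  ...   | L , U , bracket , I-ε<L , _ = ⊥-elim (≤⇒≯ (lower≤upper bracket exact refl)
          (<-respˡ-≈ I-[I-S]≈S I-ε<L))
    where
    I-[I-S]≈S : I - (I - S) ≈ S
    I-[I-S]≈S = begin
      I - (I - S)  ≈⟨ +-congˡ (-‿anti-homo I S) ⟩
      I + (S - I)  ≈⟨ +-comm I (S - I) ⟩
      S - I + I    ≈⟨ x-y+y≈x I S ⟩
      S            ∎

  -- The integral of `γ` as a finite sum

  pos-suc : ∀ {n} (p : Fin n) → pos (suc p) ≈ pos (inject₁ p) + 1#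
  pos-suc p = trans (+-comm 1# _)
    (+-congʳ (reflexive (≡.cong (λ m → ι (+ suc m)) (≡.sym (Fin.toℕ-inject₁ p)))))

  -- Every `g` is the increment of its own prefix sums, so the sum telescopes. A difference of
  -- prefix sums suits induction on the left end, without unfolding the filtered list.
  ∑-interval : ∀ {n} (g : Fin n → Carrier) {i j} → i Fin.≤ j →
               ∑ (interval i j) g ≈ prefixᴿ g j - prefixᴿ g i
  ∑-interval g {i} {j} i≤j = trans (∑-cong difference (interval i j)) (telescope (prefixᴿ g) i≤j)
    where
    difference : ∀ p → g p ≈ prefixᴿ g (suc p) - prefixᴿ g (inject₁ p)
    difference p = begin
      g p                                                 ≈⟨ +-identityʳ _ ⟨
      g p + 0#                                            ≈⟨ +-congˡ (-‿inverseʳ _) ⟨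
      g p + (prefixᴿ g (inject₁ p) - prefixᴿ g (inject₁ p))  ≈⟨ +-assoc _ _ _ ⟨
      g p + prefixᴿ g (inject₁ p) - prefixᴿ g (inject₁ p)    ≈⟨ +-congʳ (trans (prefixᴿ-step g p) (+-comm _ _)) ⟨
      prefixᴿ g (suc p) - prefixᴿ g (inject₁ p)             ∎

  -- A `Bracket` grows at its left end, hence the downward induction on `i`. `S` is existential
  -- because `step` yields products with widths, which match the prefix difference only up to `≈`.
  step-function-bracket : ∀ {n} (f : Carrier → Carrier) (g : Fin n → Carrier) →
    (∀ p v → pos (inject₁ p) < v → v < pos (suc p) → f v ≈ g p) →
    ∀ {j} i → i Fin.≤ j →
    ∃ λ S → Bracket f (pos j) (pos i) S S × S ≈ prefixᴿ g j - prefixᴿ g i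
  step-function-bracket {n} f g f≈g {j} = >-weakInduction P last cut
    where
    h : Fin (suc n) → Carrier
    h = prefixᴿ g

    P : Pred (Fin (suc n)) 0ℓ
    P i = i Fin.≤ j → ∃ λ S → Bracket f (pos j) (pos i) S S × S ≈ h j - h i

    at-end : ∀ {i} → i ≡ j → P i
    at-end ≡.refl _ = 0# , end , sym (-‿inverseʳ (h j))

    last : P (fromℕ n)
    last n≤j = at-end (Fin.≤-antisym n≤j (Fin.≤fromℕ j)) n≤j

    cut : ∀ p → P (suc p) → P (inject₁ p)
    -- The induction starts at the last index but the bracket ends at `j`: `P` is vacuous beyond
    -- `j`, and at `j` the empty bracket takes over.
    cut p rec p≤j with inject₁ p Fin.≟ j
    ... | yes p≡j = at-end p≡j p≤j
    ... | no  p≢j with rec (≡.subst (ℕ._< toℕ j) (Fin.toℕ-inject₁ p) (Fin.≤∧≢⇒< p≤j p≢j))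
    ...   | S , rest , S≈ = _ ,
            step (<-respʳ-≈ (sym (pos-suc p)) (x<x+1 _))
              (λ v p<v v<1+p → inj₂ (sym (f≈g p v p<v v<1+p)) , inj₂ (f≈g p v p<v v<1+p)) rest ,
            (begin
              g p * (pos (suc p) - pos (inject₁ p)) + S         ≈⟨ +-cong (*-congˡ width) S≈ ⟩
              g p * 1# + (h j - h (suc p))                      ≈⟨ +-congʳ (*-identityʳ (g p)) ⟩
              g p + (h j - h (suc p))                           ≈⟨ +-congʳ (sym g≈) ⟩
              (h (suc p) - h (inject₁ p)) + (h j - h (suc p))   ≈⟨ add-differences _ _ _ ⟩
              h j - h (inject₁ p)                               ∎)
      where
      x+y-x≈y : ∀ x y → x + y - x ≈ y
      x+y-x≈y x y = begin
        x + y - x    ≈⟨ +-congʳ (+-comm x y) ⟩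
        y + x - x    ≈⟨ +-assoc y x (- x) ⟩
        y + (x - x)  ≈⟨ +-congˡ (-‿inverseʳ x) ⟩
        y + 0#       ≈⟨ +-identityʳ y ⟩
        y            ∎

      width : pos (suc p) - pos (inject₁ p) ≈ 1#
      width = trans (+-congʳ (pos-suc p)) (x+y-x≈y _ _)

      g≈ : h (suc p) - h (inject₁ p) ≈ g p
      g≈ = trans (+-congʳ (prefixᴿ-step g p)) (x+y-x≈y _ _)

  ⌊⌋-pos : ∀ {n} (i : Fin n) {v} → pos i < v → v < pos i + 1# → ⌊ v ⌋ ≡ + suc (toℕ i)
  ⌊⌋-pos i i<v v<i+1 = floor-unique (+ suc (toℕ i)) (inj₁ i<v) (<-respʳ-≈ (sym (ι-1+ (+ suc (toℕ i)))) v<i+1)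

  γ-piece : ∀ {n} (w : Permutation′ (suc n)) (x : Coords Carrier n) p v →
            pos (inject₁ p) < v → v < pos (suc p) →
            γ w x v ≡ signed x (w ⟨$⟩ʳ inject₁ p) (w ⟨$⟩ʳ suc p)
  γ-piece {n} w x p v p<v v<1+p = ≡.cong₂ (valueAt w x)
    (≡.trans (≡.cong (index n) (⌊⌋-pos (inject₁ p) p<v (<-respʳ-≈ (pos-suc p) v<1+p))) (index-toℕ (inject₁ p)))
    (≡.trans (≡.cong (index n) (⌊⌋-pos (suc p) (<-respˡ-≈ (sym (pos-suc p)) (+-monoˡ-< 1# p<v)) (+-monoˡ-< 1# v<1+p)))
             (index-toℕ (suc p)))

  -- `γ-integrable` is abstract, so its value is identified with the sum of a newly built exact
  -- bracket whose pieces have width 1.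
  ∫γ : ∀ {n} (w : Permutation′ (suc n)) (x : Coords Carrier n) {i j} (i<j : i Fin.< j) →
       ∫ (pos i) (pos j) (γ w x) (γ-integrable w x i<j) ≈
       ∑ (interval i j) (λ p → signed x (w ⟨$⟩ʳ inject₁ p) (w ⟨$⟩ʳ suc p))
  ∫γ w x {i} {j} i<j with step-function-bracket (γ w x) (λ p → signed x (w ⟨$⟩ʳ inject₁ p) (w ⟨$⟩ʳ suc p))
    (λ p v p<v v<1+p → reflexive (γ-piece w x p v p<v v<1+p)) i (ℕ.<⇒≤ i<j)
  ... | S , exact , S≈ = trans (exact-bracket⇒integral (proj₂ (γ-integrable w x i<j)) exact)
          (trans S≈ (sym (∑-interval _ (ℕ.<⇒≤ i<j))))

  -- Inversions

  e-same : ∀ {n} (i : Fin (suc n)) → e i i ≡ 1#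
  e-same i = ≡.cong (λ b → if b then 1# else 0#) (dec-true (i Fin.≟ i) ≡.refl)

  e-other : ∀ {n} {i p : Fin (suc n)} → i ≢ p → e i p ≡ 0#
  e-other {i = i} {p} i≢p = ≡.cong (λ b → if b then 1# else 0#) (dec-false (i Fin.≟ p) i≢p)

  0≤e : ∀ {n} (i p : Fin (suc n)) → 0# ≤ e i p
  0≤e i p with i Fin.≟ p
  ... | yes _ = inj₁ 0<1
  ... | no _  = inj₂ refl

  -- At coordinate `c` the right side is 1, since `c ≢ d`; if `a ≢ c`, the left side is
  -- `0# - e b c`, which is at most 0.
  root-injectiveˡ : ∀ {n} {a b c d : Fin (suc n)} → c ≢ d →
                    (∀ p → root a b p ≈ root c d p) → a ≡ c
  root-injectiveˡ {a = a} {b} {c} {d} c≢d eq with a Fin.≟ c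
  ... | yes a≡c = a≡c
  ... | no  a≢c = ⊥-elim (≤⇒≯ (0≤e b c) (0<y-x⇒x<y (<-respʳ-≈ 1≈-e 0<1)))
    where
    1≈-e : 1# ≈ 0# - e b c
    1≈-e = begin
      1#              ≈⟨ +-identityʳ 1# ⟨
      1# + 0#         ≈⟨ +-congˡ -0≈0 ⟨
      1# - 0#         ≡⟨ ≡.cong₂ _-_ (e-same c) (e-other (c≢d ∘ ≡.sym)) ⟨
      root c d c      ≈⟨ eq c ⟨
      e a c - e b c   ≡⟨ ≡.cong (_- e b c) (e-other a≢c) ⟩
      0# - e b c      ∎

  root-swap : ∀ {n} (a b p : Fin (suc n)) → - root a b p ≈ root b a p
  root-swap a b p = -‿anti-homo (e a p) (e b p)

  -- Coordinate `p` of w⁻¹(e_i) tests i = w(p), that of e_{w⁻¹(i)} tests w⁻¹(i) = p. Equivalent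
  -- tests have the same boolean, so the equality is `≡`.
  root-action : ∀ {n} (w : Permutation′ (suc n)) i j p →
                (flip w · root i j) p ≡ root (w ⟨$⟩ˡ i) (w ⟨$⟩ˡ j) p
  root-action w i j p = ≡.cong₂ _-_ (e-action i) (e-action j)
    where
    e-action : ∀ i → e i (w ⟨$⟩ʳ p) ≡ e (w ⟨$⟩ˡ i) p
    e-action i = ≡.cong (λ b → if b then 1# else 0#) (does-⇔
      (mk⇔ (λ i≡wp → ≡.trans (≡.cong (w ⟨$⟩ˡ_) i≡wp) (inverseˡ w))
           (λ w⁻¹i≡p → ≡.trans (≡.sym (inverseʳ w)) (≡.cong (w ⟨$⟩ʳ_) w⁻¹i≡p)))
      (i Fin.≟ (w ⟨$⟩ʳ p)) ((w ⟨$⟩ˡ i) Fin.≟ p))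

  -- `N` is defined on vectors, while `F` branches on the order of indices; this and `N⇒inversion`
  -- link the two.
  inversion⇒N : ∀ {n} (w : Permutation′ (suc n)) {i j} → i Fin.< j →
                (w ⟨$⟩ˡ j) Fin.< (w ⟨$⟩ˡ i) → N w (root i j)
  inversion⇒N w {i} {j} i<j b<a = (i , j , i<j , λ _ → refl) , (w ⟨$⟩ˡ j , w ⟨$⟩ˡ i , b<a ,
    λ p → trans (-‿cong (reflexive (root-action w i j p))) (root-swap (w ⟨$⟩ˡ i) (w ⟨$⟩ˡ j) p))

  -- The negative root in `N` comes with its own indices `c < d`; two comparisons of roots identify
  -- them with `b` and `a`.
  N⇒inversion : ∀ {n} (w : Permutation′ (suc n)) {i j} → N w (root i j) →
                (w ⟨$⟩ˡ j) Fin.< (w ⟨$⟩ˡ i)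
  N⇒inversion w {i} {j} (_ , c , d , c<d , eq) = ≡.subst₂ Fin._<_ (≡.sym b≡c) (≡.sym a≡d) c<d
    where
    a b : Fin _
    a = w ⟨$⟩ˡ i
    b = w ⟨$⟩ˡ j

    -root≈ : ∀ p → - root a b p ≈ root c d p
    -root≈ p = trans (-‿cong (reflexive (≡.sym (root-action w i j p)))) (eq p)

    b≡c : b ≡ c
    b≡c = root-injectiveˡ {a = b} {a} (Fin.<⇒≢ c<d) λ p → trans (sym (root-swap a b p)) (-root≈ p)

    a≡d : a ≡ d
    -- Negating both sides turns the second indices into first ones, where `root-injectiveˡ`
    -- applies.
    a≡d = root-injectiveˡ {a = a} {b} (Fin.<⇒≢ c<d ∘ ≡.sym) λ p →
      trans (sym (-‿involutive _)) (trans (-‿cong (-root≈ p)) (root-swap c d p))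

  -- The representation `F` and the action `⋄`

  -- `signed` absorbs the change of sign in `F`, so only the shift by -1 distinguishes inversions
  -- from other roots.
  F-N : ∀ {n} (w : Permutation′ (suc n)) (x : Coords Carrier n) {i j} (i<j : i Fin.< j) →
        N w (root i j) → F w x i j i<j ≈ signed x (w ⟨$⟩ˡ i) (w ⟨$⟩ˡ j) - 1#
  F-N w x {i} {j} i<j α∈N with Fin.<-cmp (w ⟨$⟩ˡ i) (w ⟨$⟩ˡ j)
  ... | tri< _ _ b≮a = ⊥-elim (b≮a (N⇒inversion w α∈N))
  ... | tri≈ _ _ b≮a = ⊥-elim (b≮a (N⇒inversion w α∈N))
  -- `signed` branches on the same comparison, so both sides reduce together.
  ... | tri> _ _ _   = refl

  F-¬N : ∀ {n} (w : Permutation′ (suc n)) (x : Coords Carrier n) {i j} (i<j : i Fin.< j) →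
         ¬ N w (root i j) → F w x i j i<j ≈ signed x (w ⟨$⟩ˡ i) (w ⟨$⟩ˡ j)
  F-¬N w x {i} {j} i<j α∉N with Fin.<-cmp (w ⟨$⟩ˡ i) (w ⟨$⟩ˡ j)
  ... | tri< _ _ _   = refl
  ... | tri≈ _ a≡b _ = ⊥-elim (Fin.<⇒≢ i<j (injective w a≡b))
  ... | tri> _ _ b<a = ⊥-elim (α∉N (inversion⇒N w i<j b<a))

  -- Each element satisfying `P` costs 1, so the defect counts them. With `P` the simple inversions,
  -- this is the source of |B| in the formula.
  ∑-filter : ∀ {A : Set} {P : Pred A 0ℓ} (P? : Decidable P) {f g : A → Carrier} →
             (∀ p → P p → f p ≈ g p - 1#) → (∀ p → ¬ P p → f p ≈ g p) →
             ∀ ps → ∑ ps f ≈ ∑ ps g - ι (+ length (filter P? ps))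
  ∑-filter P? on off [] = sym (-‿inverseʳ 0#)
  ∑-filter P? {f} {g} on off (p ∷ ps) with P? p | ∑-filter P? on off ps
  ... | no  ¬Pp | rec = trans (+-cong (off p ¬Pp) rec) (sym (+-assoc _ _ _))
  ... | yes Pp  | rec = begin
    f p + ∑ ps f                       ≈⟨ +-cong (on p Pp) rec ⟩
    (g p - 1#) + (∑ ps g - ι (+ m))    ≈⟨ CM.solve 4 (λ a b c d → ((a CM.⊕ b) CM.⊕ (c CM.⊕ d)) CM.⊜ ((a CM.⊕ c) CM.⊕ (b CM.⊕ d))) refl _ _ _ _ ⟩
    -- `1# + ι (+ m)` is `ι (+ suc m)` by definition.
    (g p + ∑ ps g) + (- 1# - ι (+ m))  ≈⟨ +-congˡ (-‿+-comm 1# (ι (+ m))) ⟩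
    (g p + ∑ ps g) - ι (+ suc m)       ∎
    where
    m : ℕ
    m = length (filter P? ps)

  -- Taking `h = 0` in `Offset` leaves exactly the entries of `lam`.
  real-∈X : ∀ {n} (lam : Admitted n) → X[ lam ] (real (entry lam))
  real-∈X lam = Offset⇒X lam {h = λ _ → 0#} {x = real (entry lam)}
    λ i j i<j → sym (trans (+-congʳ (-‿inverseʳ 0#)) (+-identityˡ _))

  -- Evaluates the defining equations of X[ w ⋄ lam ] at its point F w lam.
  ⋄-entry : ∀ {n} (w : Permutation′ (suc n)) (lam : Admitted n) {i j} (i<j : i Fin.< j) →
    let Λ = real (entry lam) in
    ι (entry (w ⋄ lam) i j i<j) ≈
    F w Λ i j i<j
      - ∑ (interval i j) (λ p → signed Λ (w ⟨$⟩ˡ inject₁ p) (w ⟨$⟩ˡ suc p))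
      + ι (+ length (filter (λ p → N? w (root (inject₁ p) (suc p))) (interval i j)))
  ⋄-entry {n} w lam {i} {j} i<j = solve-for-m (begin
    F w Λ i j i<j      ≈⟨ proj₁ (⋄-spec w lam) (Λ , real-∈X lam , λ _ _ _ → refl) i j i<j ⟩
    ∑ (interval i j) (λ p → F w Λ (inject₁ p) (suc p) (p<p+1 p)) + ι (entry (w ⋄ lam) i j i<j)
      ≈⟨ +-congʳ (∑-filter (λ p → N? w (root (inject₁ p) (suc p)))
           (λ p → F-N w Λ (p<p+1 p)) (λ p → F-¬N w Λ (p<p+1 p)) (interval i j)) ⟩
    _                  ∎)
    where
    Λ : Coords Carrier n
    Λ = real (entry lam)

    solve-for-m : ∀ {x s c m} → x ≈ (s - c) + m → m ≈ x - s + c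
    solve-for-m {x} {s} {c} {m} x≈ = sym (begin
      x - s + c                    ≈⟨ +-congʳ (+-congʳ x≈) ⟩
      (s - c) + m - s + c          ≈⟨ CM.solve 5 (λ s -c m -s c → ((((s CM.⊕ -c) CM.⊕ m) CM.⊕ -s) CM.⊕ c) CM.⊜ (m CM.⊕ ((s CM.⊕ -s) CM.⊕ (c CM.⊕ -c)))) refl s (- c) m (- s) c ⟩
      m + ((s - s) + (c - c))      ≈⟨ +-congˡ (+-cong (-‿inverseʳ s) (-‿inverseʳ c)) ⟩
      m + (0# + 0#)                ≈⟨ +-congˡ (+-identityˡ 0#) ⟩
      m + 0#                       ≈⟨ +-identityʳ m ⟩
      m                            ∎)

  -- The case of a transposition

  module _ {n : ℕ} (lam : Admitted n) {i j : Fin (suc n)} (i<j : i Fin.< j)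
           {k l : Fin (suc n)} (k<l : k Fin.< l) where
    private
      t : Permutation′ (suc n)
      t = transpose k l

      Λ : Coords Carrier n
      Λ = real (entry lam)

      I c main : Carrier
      I = ∫ (pos i) (pos j) (γ t Λ) (γ-integrable t Λ i<j)
      c = ι (+ length (B i j k l))
      main = signed Λ (t ⟨$⟩ʳ i) (t ⟨$⟩ʳ j) - I + c

      signed-flip : ∀ a b → signed Λ (t ⟨$⟩ˡ a) (t ⟨$⟩ˡ b) ≈ signed Λ (t ⟨$⟩ʳ a) (t ⟨$⟩ʳ b)
      signed-flip a b = reflexive (≡.cong₂ (signed Λ) (flip≡ a) (flip≡ b))
        where flip≡ = transpose-comm (Fin.<⇒≢ k<l)

      -- The two cases of the theorem differ only in the value of `F t Λ` at (i , j). The sum in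
      -- `⋄-entry` becomes `I`, and its count is `c` since `B` is by definition the same filtered
      -- list.
      entry-from-F : ∀ {s} → F t Λ i j i<j ≈ s → ι (entry (t ⋄ lam) i j i<j) ≈ s - I + c
      entry-from-F F≈s = trans (⋄-entry t lam i<j) (+-congʳ (+-cong F≈s (-‿cong
        (trans (∑-cong (λ p → signed-flip (inject₁ p) (suc p)) (interval i j)) (sym (∫γ t Λ i<j))))))

    transposition-⋄-entry-∉N : ¬ N t (root i j) → ι (entry (t ⋄ lam) i j i<j) ≈ main
    transposition-⋄-entry-∉N α∉N = entry-from-F (trans (F-¬N t Λ i<j α∉N) (signed-flip i j))

    transposition-⋄-entry-∈N : N t (root i j) → ι (entry (t ⋄ lam) i j i<j) ≈ main - 1#
    transposition-⋄-entry-∈N α∈N = trans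
      (entry-from-F (trans (F-N t Λ i<j α∈N) (+-congʳ (signed-flip i j))))
      (CM.solve 4 (λ s o i c → (((s CM.⊕ o) CM.⊕ i) CM.⊕ c) CM.⊜ (((s CM.⊕ i) CM.⊕ c) CM.⊕ o)) refl _ (- 1#) (- I) c)

open import Defs

theorem3p1 :
    ⦃ ℝ : Reals ⦄ (n : ℕ) → 1 ℕ.≤ n → (lam : Admitted n) →
    (i j : Fin (suc n)) (i<j : i Fin.< j) →
    (k l : Fin (suc n)) → k Fin.< l →
    let t = transpose k l
        Λ = real (entry lam)
        α = root i j
        main = signed Λ (t ⟨$⟩ʳ i) (t ⟨$⟩ʳ j)
                 - ∫ (pos i) (pos j) (γ t Λ) (γ-integrable t Λ i<j)
                 + ι (+ length (B i j k l))
    in (¬ N t α → ι (entry (t ⋄ lam) i j i<j) ≈ main)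
     × (N t α → ι (entry (t ⋄ lam) i j i<j) ≈ main - 1#)
theorem3p1 ⦃ ℝ ⦄ _ _ lam _ _ i<j _ _ k<l =
  transposition-⋄-entry-∉N ℝ lam i<j k<l , transposition-⋄-entry-∈N ℝ lam i<j k<l
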